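{- Let $\mathfrak M$ be a relational structure with domain $\Sigma$ and let $\mathfrak N=(N;R_1,\dots,R_k)$ be a relational structure which is $\mathfrak M$-automatic via an injective map $\mu:N\to\Sigma^*$. Then: (1) for every relation $R$ first-order definable in $\mathfrak N$, its image $\mu(R)$ is $\mathfrak M$-recognizable; (2) the first-order theory of $\mathfrak N$ is (effectively) reducible to the first-order theory of $\mathfrak M$; in particular it is decidable if the first-order theory of $\mathfrak M$ is.
   Context: Let $\mathfrak L$ be a relational language and $\mathfrak M$ an $\mathfrak L$-structure with domain $\Sigma$ (finite or infinite). Let $\#\notin\Sigma$ and let $\mathfrak M_\#$ be the $\mathfrak L\cup\{P_\#\}$-structure with domain $\Sigma\cup\{\#\}$, every symbol of $\mathfrak L$ interpreted as in $\mathfrak M$ and $P_\#(x)$ holding iff $x=\#$. For $w=(w_1,\dots,w_n)\in(\Sigma^*)^n$, $\langle w\rangle$ is the word over $(\Sigma\cup\{\#\})^n$ of length $\max_i|w_i|$ obtained by right-padding each $w_i$ with $\#$'s and reading them in parallel. An $\mathfrak M$-automaton with $n$ tapes is $(Q,n,E,I,T)$ with $Q$ a finite set of states, $I,T\subseteq Q$, and a finite set of transitions $E\subseteq Q\times\mathcal F_n\times Q$, $\mathcal F_n$ the set of first-order $\mathfrak L\cup\{P_\#\}$-formulas with $n$ free variables; $w$ is accepted if, writing $\langle w\rangle=u_0\cdots u_{m-1}$, there are states $q_0\in I,q_1,\dots,q_m\in T$ such that for each $i<m$ some $(q_i,\varphi,q_{i+1})\in E$ satisfies $\mathfrak M_\#\models\varphi(u_i)$.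 A relation $X\subseteq(\Sigma^*)^n$ is $\mathfrak M$-recognizable if it is the set of tuples accepted by some $\mathfrak M$-automaton with $n$ tapes. A structure $\mathfrak N=(N;R_1,\dots,R_k)$ is $\mathfrak M$-automatic (via $\mu$) if $\mu:N\to\Sigma^*$ is injective and the images $\mu(N)$ and $\mu(R_j)=\{(\mu(a_1),\dots,\mu(a_r)):(a_1,\dots,a_r)\in R_j\}$ are all $\mathfrak M$-recognizable. -}

module Defs where

open import Axiom.ExcludedMiddle using (ExcludedMiddle)
open import Data.Bool.Base using (Bool; T)
open import Data.Empty using (⊥)
open import Data.Fin.Base using (Fin)
open import Data.Fin.Subset using (Subset) renaming (_∈_ to _∈ₛ_)
open import Data.List.Base as List using (List; []; _∷_; length; drop; head; applyUpTo)
open import Data.List.Membership.Propositional renaming (_∈_ to _∈ₗ_)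
open import Data.Maybe.Base using (Maybe; just; nothing)
open import Data.Nat.Base using (ℕ; suc; _⊔_)
open import Data.Product.Base using (Σ-syntax; ∃-syntax; _×_; _,_)
open import Data.Sum.Base using (_⊎_)
open import Data.Vec.Base as Vec using (Vec; []; _∷_; lookup; map; foldr′)
open import Function.Bundles using (_⇔_)
open import Function.Definitions using (Injective)
open import Level as Level using (0ℓ)
open import Relation.Binary.PropositionalEquality using (_≡_)
open import Relation.Unary using (Pred; _∈_; U)

-- First-order logic with equality

record Language : Set₁ where
  field
    Symbol : Set
    arity  : Symbol → ℕ

open Language public

-- The language of a structure (N; R₁, …, Rₖ), from the arities of R₁, …, Rₖ.
finiteLanguage : ∀ {k} → Vec ℕ k → Language
finiteLanguage {k} arities = record { Symbol = Fin k ; arity = lookup arities }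

record Structure (L : Language) : Set₁ where
  field
    Carrier : Set
    ⟦_⟧     : (R : Symbol L) → Pred (Vec Carrier (arity L R)) 0ℓ

open Structure public using (Carrier)

infix  9 _≈_
infixr 7 _∧_
infixr 6 _∨_
infixr 5 _⇒_

-- Formula L n has its free variables among n de Bruijn indices; a quantifier
-- binds index zero.
data Formula (L : Language) (n : ℕ) : Set where
  rel         : (R : Symbol L) → Vec (Fin n) (arity L R) → Formula L n
  _≈_         : Fin n → Fin n → Formula L n
  false       : Formula L n
  _∧_ _∨_ _⇒_ : Formula L n → Formula L n → Formula L n
  all ex      : Formula L (suc n) → Formula L n

Sentence : Language → Set
Sentence L = Formula L 0

_⊨_[_] : ∀ {L n} (M : Structure L) → Formula L n → Vec (Carrier M) n → Set
M ⊨ rel R xs [ ρ ] = map (lookup ρ) xs ∈ Structure.⟦_⟧ M R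
M ⊨ x ≈ y    [ ρ ] = lookup ρ x ≡ lookup ρ y
M ⊨ false    [ ρ ] = ⊥
M ⊨ φ ∧ ψ    [ ρ ] = M ⊨ φ [ ρ ] × M ⊨ ψ [ ρ ]
M ⊨ φ ∨ ψ    [ ρ ] = M ⊨ φ [ ρ ] ⊎ M ⊨ ψ [ ρ ]
M ⊨ φ ⇒ ψ    [ ρ ] = M ⊨ φ [ ρ ] → M ⊨ ψ [ ρ ]
M ⊨ all φ    [ ρ ] = ∀ a → M ⊨ φ [ a ∷ ρ ]
M ⊨ ex φ     [ ρ ] = ∃[ a ] M ⊨ φ [ a ∷ ρ ]

Theory : ∀ {L} → Structure L → Pred (Sentence L) 0ℓ
Theory M σ = M ⊨ σ [ [] ]

-- Definability without parameters.
FirstOrderDefinable : ∀ {L n} (N : Structure L) → Pred (Vec (Carrier N) n) 0ℓ → Set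
FirstOrderDefinable {L} {n} N R =
  Σ[ φ ∈ Formula L n ] (∀ v → v ∈ R ⇔ N ⊨ φ [ v ])

-- The padded structure M_#

data Symbol♯ (S : Set) : Set where
  old : S → Symbol♯ S
  P♯  : Symbol♯ S

infix 30 _♯

_♯ : Language → Language
L ♯ = record
  { Symbol = Symbol♯ (Symbol L)
  ; arity  = λ { (old R) → arity L R ; P♯ → 1 }
  }

-- The domain Σ ∪ {#} is Maybe Σ, with # represented by nothing.  The relations
-- of M are unchanged as sets of tuples, so they never hold of a tuple
-- containing #.
pad : ∀ {L} → Structure L → Structure (L ♯)
pad M = record
  { Carrier = Maybe (Carrier M)
  ; ⟦_⟧     = λ { (old R) us      → ∃[ as ] as ∈ Structure.⟦_⟧ M R × us ≡ map just as
                ; P♯      (u ∷ []) → u ≡ nothing }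
  }

-- The i-th letter of a word, or # from the end of the word onwards.
letter : ∀ {A : Set} → ℕ → List A → Maybe A
letter i w = head (drop i w)

⟨_⟩ : ∀ {A : Set} {n} → Vec (List A) n → List (Vec (Maybe A) n)
⟨ ws ⟩ = applyUpTo (λ i → map (letter i) ws) (foldr′ _⊔_ 0 (map length ws))

-- M-automata

record Automaton (L : Language) (n : ℕ) : Set where
  field
    size        : ℕ
    transitions : List (Fin size × Formula (L ♯) n × Fin size)
    initial     : Subset size
    terminal    : Subset size

  State : Set
  State = Fin size

module _ {L : Language} {n : ℕ} (M : Structure L) (A : Automaton L n) where
  open Automaton A

  data Run : State → List (Vec (Maybe (Carrier M)) n) → State → Set where
    []   : ∀ {q} → Run q [] q
    step : ∀ {p q r φ u us} → (p , φ , q) ∈ₗ transitions → pad M ⊨ φ [ u ] →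
           Run q us r → Run p (u ∷ us) r

  Accepts : Pred (Vec (List (Carrier M)) n) 0ℓ
  Accepts ws = ∃[ p ] ∃[ q ] p ∈ₛ initial × q ∈ₛ terminal × Run p ⟨ ws ⟩ q

Recognizable : ∀ {L n} (M : Structure L) → Pred (Vec (List (Carrier M)) n) 0ℓ → Set
Recognizable {L} {n} M X = Σ[ A ∈ Automaton L n ] (∀ ws → ws ∈ X ⇔ ws ∈ Accepts M A)

image : ∀ {A B : Set} {n} → (A → B) → Pred (Vec A n) 0ℓ → Pred (Vec B n) 0ℓ
image μ R ws = ∃[ v ] v ∈ R × ws ≡ map μ v

record AutomaticVia {L K : Language} (M : Structure L) (N : Structure K)
                    (μ : Carrier N → List (Carrier M)) : Set where
  field
    injective : Injective _≡_ _≡_ μ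
    domain    : Recognizable M (image {n = 1} μ U)
    relations : ∀ R → Recognizable M (image μ (Structure.⟦_⟧ N R))

-- Effectivity.  As usual in synthetic computability, the computable functions
-- are the functions of the ambient constructive type theory.  First-order truth
-- is classical, so the correctness of a function may be established using
-- excluded middle.  The function itself is chosen before excluded middle is
-- assumed, hence cannot depend on it.

Classically : ∀ {p} → Set p → Set (Level.suc 0ℓ Level.⊔ p)
Classically P = ExcludedMiddle 0ℓ → P

EffectivelyReducible : ∀ {A B : Set} → Pred A 0ℓ → Pred B 0ℓ → Set₁
EffectivelyReducible {A} {B} P Q =
  Σ[ f ∈ (A → B) ] Classically (∀ a → a ∈ P ⇔ f a ∈ Q)

EffectivelyDecidable : ∀ {A : Set} → Pred A 0ℓ → Set₁
EffectivelyDecidable {A} P =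
  Σ[ d ∈ (A → Bool) ] Classically (∀ a → a ∈ P ⇔ T (d a))

{-# OPTIONS --safe #-}

-- For every formula φ of N one constructs an automaton that accepts the convolution of
-- the words μ a₁, …, μ aₙ, padded to any sufficient length, iff N ⊨ φ(a₁, …, aₙ):
-- conjunction is a product, negation the subset construction, and ∃ a projection.
-- Which states become final under projection depends on the theory of M.  The
-- construction remains effective because the initial and final states are specified
-- symbolically, by sentences about M_#.  A sentence of N gives an automaton without
-- tapes, hence the single sentence "some initial state is final" about M_#; treating #
-- separately in every quantifier translates it to one about M.  For the first claim,
-- excluded middle decides the sentences and makes the automaton an ordinary one.

module Submission where

open import Defs
open import Axiom.ExcludedMiddle using (ExcludedMiddle)
open import Data.Bool.Base as Bool using (Bool; if_then_else_; T)
open import Data.Bool.Properties using (T-≡)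
open import Data.Fin.Base using (Fin; zero; suc; remQuot; combine; finToFun; funToFin)
import Data.Fin.Properties as Fin
import Data.Fin.Subset as Subset
open import Data.List.Base as List
  using (List; []; _∷_; _++_; length; applyUpTo; allFin; cartesianProduct)
open import Data.List.Membership.Propositional using () renaming (_∈_ to _∈ₗ_)
open import Data.List.Membership.Propositional.Properties
  using (∈-map⁺; ∈-map⁻; ∈-cartesianProduct⁺; ∈-allFin)
open import Data.List.Properties
  using (∷-injective; length-map; length-replicate; length-applyUpTo; map-applyUpTo)
open import Data.List.Relation.Unary.All as All using (All; []; _∷_)
import Data.List.Relation.Unary.All.Properties as All
open import Data.List.Relation.Unary.Any using (here; there)
open import Data.Maybe.Base as Maybe using (Maybe; just; nothing)
open import Data.Maybe.Properties as Maybe using (just-injective)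
open import Data.Nat.Base
  using (ℕ; zero; suc; _+_; _*_; _^_; _∸_; _⊔_; _≤_; _<_; z≤n; s≤s; s<s)
import Data.Nat.Properties as ℕ
open import Data.Product.Base using (∃-syntax; _×_; _,_; proj₁; proj₂)
open import Data.Product.Function.NonDependent.Propositional using (_×-⇔_)
open import Data.Sum.Base using (inj₁; inj₂; [_,_])
open import Data.Sum.Function.Propositional using (_⊎-⇔_)
open import Data.Vec.Base as Vec using (Vec; []; _∷_; lookup; map; replicate; tabulate; foldr′)
open import Data.Vec.Properties
  using ( map-cong; map-∘; map-replicate; lookup-map; lookup-replicate; lookup∘tabulate
        ; tabulate∘lookup; tabulate-∘; tabulate-cong; []=⇒lookup; lookup⇒[]=)
open import Function.Base using (_∘_; id)
open import Function.Bundles using (_⇔_; mk⇔; Equivalence)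
open import Function.Construct.Composition using () renaming (_⇔-∘_ to infixr 1 _⇔-∘_)
open import Function.Construct.Identity using (⇔-id)
open import Function.Construct.Symmetry using (⇔-sym)
open import Function.Related.TypeIsomorphisms using (→-cong-⇔)
open import Level using (0ℓ)
open import Relation.Binary.PropositionalEquality
  using (_≡_; _≢_; refl; sym; trans; cong; cong₂; subst)
open import Relation.Nullary using (Dec; yes; no; ¬_; does; contradiction)
open import Relation.Nullary.Decidable using (map′; decidable-stable)
open import Relation.Unary using (Pred; _∈_)

open Equivalence using (to; from)

private variable
  L K : Language
  k m n : ℕ
  A B : Set

-- Booleans and logical equivalences

T-does : (A? : Dec A) → T (does A?) ⇔ A
T-does (yes a) = mk⇔ (λ _ → a) _
T-does (no ¬a) = mk⇔ (λ ()) ¬a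

T-lookup : (S : Subset.Subset n) (i : Fin n) → T (lookup S i) ⇔ i Subset.∈ S
T-lookup S i = mk⇔ (lookup⇒[]= i S ∘ to T-≡) (from T-≡ ∘ []=⇒lookup)

≡⇒⇔ : {P Q : Set} → P ≡ Q → P ⇔ Q
≡⇒⇔ refl = ⇔-id _

∀-⇔ : {P Q : A → Set} → (∀ x → P x ⇔ Q x) → (∀ x → P x) ⇔ (∀ x → Q x)
∀-⇔ P⇔Q = mk⇔ (λ f x → to (P⇔Q x) (f x)) (λ f x → from (P⇔Q x) (f x))

∃-⇔ : {P Q : A → Set} → (∀ x → P x ⇔ Q x) → (∃[ x ] P x) ⇔ (∃[ x ] Q x)
∃-⇔ P⇔Q = mk⇔ (λ (x , p) → x , to (P⇔Q x) p) (λ (x , q) → x , from (P⇔Q x) q)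

-- First-order formulas

true : Formula L n
true = false ⇒ false

infix 20 ~_

~_ : Formula L n → Formula L n
~ φ = φ ⇒ false

⌜_⌝ : Bool → Formula L n
⌜ b ⌝ = if b then true else false

⋀ : (Fin m → Formula L n) → Formula L n
⋀ {m = zero}  φ = true
⋀ {m = suc _} φ = φ zero ∧ ⋀ (φ ∘ suc)

⋁ : (Fin m → Formula L n) → Formula L n
⋁ {m = zero}  φ = false
⋁ {m = suc _} φ = φ zero ∨ ⋁ (φ ∘ suc)

rename : Vec (Fin m) n → Formula L n → Formula L m
rename σ (rel R xs) = rel R (map (lookup σ) xs)
rename σ (x ≈ y)    = lookup σ x ≈ lookup σ y
rename σ false      = false
rename σ (φ ∧ ψ)    = rename σ φ ∧ rename σ ψ
rename σ (φ ∨ ψ)    = rename σ φ ∨ rename σ ψ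
rename σ (φ ⇒ ψ)    = rename σ φ ⇒ rename σ ψ
rename σ (all φ)    = all (rename (zero ∷ map suc σ) φ)
rename σ (ex φ)     = ex (rename (zero ∷ map suc σ) φ)

map-lookup-lift : (a : A) (ρ : Vec A m) (σ : Vec (Fin m) n) →
                  map (lookup (a ∷ ρ)) (zero ∷ map suc σ) ≡ a ∷ map (lookup ρ) σ
map-lookup-lift a ρ σ = cong (a ∷_) (sym (map-∘ (lookup (a ∷ ρ)) suc σ))

map-lookup-map : (f : A → B) (us : Vec A m) (xs : Vec (Fin m) n) →
                 map (lookup (map f us)) xs ≡ map f (map (lookup us) xs)
map-lookup-map f us xs =
  trans (map-cong (λ x → lookup-map x f us) xs) (map-∘ f (lookup us) xs)

module _ (M : Structure L) where

  ⊨⌜⌝ : (b : Bool) {ρ : Vec (Carrier M) n} → M ⊨ ⌜ b ⌝ [ ρ ] ⇔ T b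
  ⊨⌜⌝ Bool.true  = mk⇔ _ (λ _ → id)
  ⊨⌜⌝ Bool.false = ⇔-id _

  ⊨⋀ : (φ : Fin m → Formula L n) {ρ : Vec (Carrier M) n} →
       M ⊨ ⋀ φ [ ρ ] ⇔ (∀ i → M ⊨ φ i [ ρ ])
  ⊨⋀ {m = zero}  φ = mk⇔ (λ _ ()) (λ _ → id)
  ⊨⋀ {m = suc m} φ = mk⇔
    (λ { (p , _) zero → p ; (_ , ps) (suc i) → to (⊨⋀ (φ ∘ suc)) ps i })
    (λ p → p zero , from (⊨⋀ (φ ∘ suc)) (p ∘ suc))

  ⊨⋁ : (φ : Fin m → Formula L n) {ρ : Vec (Carrier M) n} →
       M ⊨ ⋁ φ [ ρ ] ⇔ (∃[ i ] M ⊨ φ i [ ρ ])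
  ⊨⋁ {m = zero}  φ = mk⇔ (λ ()) (λ ())
  ⊨⋁ {m = suc m} φ = mk⇔
    [ (zero ,_) , (λ p → let (i , q) = to (⊨⋁ (φ ∘ suc)) p in suc i , q) ]
    (λ { (zero , p) → inj₁ p ; (suc i , p) → inj₂ (from (⊨⋁ (φ ∘ suc)) (i , p)) })

  ⊨rename : (σ : Vec (Fin m) n) (φ : Formula L n) (ρ : Vec (Carrier M) m) →
            M ⊨ rename σ φ [ ρ ] ⇔ M ⊨ φ [ map (lookup ρ) σ ]
  ⊨rename σ (rel R xs) ρ = ≡⇒⇔ (cong (Structure.⟦_⟧ M R) (sym (map-lookup-map (lookup ρ) σ xs)))
  ⊨rename σ (x ≈ y)    ρ =
    ≡⇒⇔ (cong₂ _≡_ (sym (lookup-map x (lookup ρ) σ)) (sym (lookup-map y (lookup ρ) σ)))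
  ⊨rename σ false      ρ = ⇔-id _
  ⊨rename σ (φ ∧ ψ)    ρ = ⊨rename σ φ ρ ×-⇔ ⊨rename σ ψ ρ
  ⊨rename σ (φ ∨ ψ)    ρ = ⊨rename σ φ ρ ⊎-⇔ ⊨rename σ ψ ρ
  ⊨rename σ (φ ⇒ ψ)    ρ = →-cong-⇔ (⊨rename σ φ ρ) (⊨rename σ ψ ρ)
  ⊨rename σ (all φ)    ρ = ∀-⇔ λ a →
    ≡⇒⇔ (cong (M ⊨ φ [_]) (map-lookup-lift a ρ σ)) ⇔-∘ ⊨rename (zero ∷ map suc σ) φ (a ∷ ρ)
  ⊨rename σ (ex φ)     ρ = ∃-⇔ λ a →
    ≡⇒⇔ (cong (M ⊨ φ [_]) (map-lookup-lift a ρ σ)) ⇔-∘ ⊨rename (zero ∷ map suc σ) φ (a ∷ ρ)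

-- Eliminating the padding symbol from formulas

justs? : (us : Vec (Maybe A) n) → Dec (∃[ as ] us ≡ map just as)
justs? []            = yes ([] , refl)
justs? (nothing ∷ _) = no λ { (_ ∷ _ , ()) }
justs? (just a ∷ us) = map′
  (λ (as , eq) → a ∷ as , cong (just a ∷_) eq)
  (λ { (_ ∷ as , eq) → as , cong Vec.tail eq })
  (justs? us)

map-just-injective : (as bs : Vec A n) → map just as ≡ map just bs → as ≡ bs
map-just-injective []       []       _  = refl
map-just-injective (a ∷ as) (b ∷ bs) eq =
  cong₂ _∷_ (just-injective (cong Vec.head eq)) (map-just-injective as bs (cong Vec.tail eq))

-- `Maybe.map f` keeps `nothing`, so no valuation can replace a # by a letter. Hence a relation of
-- `M` fails at arguments one of which is marked as #.
map-map≡map-just : (f : A → B) (us : Vec (Maybe A) n) (bs : Vec B n) →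
                   map (Maybe.map f) us ≡ map just bs → ∃[ as ] us ≡ map just as
map-map≡map-just f []            []       _  = [] , refl
map-map≡map-just f (nothing ∷ _) (_ ∷ _)  ()
map-map≡map-just f (just a ∷ us) (_ ∷ bs) eq =
  let as , eq′ = map-map≡map-just f us bs (cong Vec.tail eq) in a ∷ as , cong (just a ∷_) eq′

-- The entry of the vector says for each variable which variable of the result it
-- becomes, or that it denotes #.
unpad : Vec (Maybe (Fin k)) n → Formula (L ♯) n → Formula L k
unpad σ (rel (old R) xs) with justs? (map (lookup σ) xs)
... | yes (ys , _) = rel R ys
... | no  _        = false
unpad σ (rel P♯ (x ∷ [])) = Maybe.maybe (λ _ → false) true (lookup σ x)
unpad σ (x ≈ y) with lookup σ x | lookup σ y
... | just x′ | just y′ = x′ ≈ y′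
... | just _  | nothing = false
... | nothing | just _  = false
... | nothing | nothing = true
unpad σ false   = false
unpad σ (φ ∧ ψ) = unpad σ φ ∧ unpad σ ψ
unpad σ (φ ∨ ψ) = unpad σ φ ∨ unpad σ ψ
unpad σ (φ ⇒ ψ) = unpad σ φ ⇒ unpad σ ψ
unpad σ (all φ) = unpad (nothing ∷ σ) φ ∧ all (unpad (just zero ∷ map (Maybe.map suc) σ) φ)
unpad σ (ex φ)  = unpad (nothing ∷ σ) φ ∨ ex (unpad (just zero ∷ map (Maybe.map suc) σ) φ)

module _ (M : Structure L) where

  padValuation : Vec (Carrier M) k → Vec (Maybe (Fin k)) n → Vec (Maybe (Carrier M)) n
  padValuation ρ σ = map (Maybe.map (lookup ρ)) σ

  padValuation-∷ : (a : Carrier M) (ρ : Vec (Carrier M) k) (σ : Vec (Maybe (Fin k)) n) →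
                   padValuation (a ∷ ρ) (map (Maybe.map suc) σ) ≡ padValuation ρ σ
  padValuation-∷ a ρ σ = trans (sym (map-∘ _ _ σ)) (map-cong (sym ∘ Maybe.map-∘) σ)

  -- Since `σ` fixes which variables denote #, every atom that involves # has a known truth value. A
  -- quantifier over the padded domain splits into the value # and a quantifier over the letters.
  ⊨unpad : (σ : Vec (Maybe (Fin k)) n) (φ : Formula (L ♯) n) (ρ : Vec (Carrier M) k) →
           M ⊨ unpad σ φ [ ρ ] ⇔ pad M ⊨ φ [ padValuation ρ σ ]
  ⊨unpad-quantified : (σ : Vec (Maybe (Fin k)) n) (φ : Formula (L ♯) (suc n))
    (ρ : Vec (Carrier M) k) (a : Carrier M) →
    M ⊨ unpad (just zero ∷ map (Maybe.map suc) σ) φ [ a ∷ ρ ] ⇔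
    pad M ⊨ φ [ just a ∷ padValuation ρ σ ]

  ⊨unpad σ (rel (old R) xs) ρ
    rewrite map-lookup-map (Maybe.map (lookup ρ)) σ xs
    with justs? (map (lookup σ) xs)
  ... | yes (ys , eq) rewrite eq = mk⇔
    (λ p → map (lookup ρ) ys , p , just-map)
    -- `pad` supplies some tuple `as` of letters; injectivity of `just` identifies it with the
    -- values of `ys`.
    (λ (as , p , eq′) → subst (Structure.⟦_⟧ M R)
      (map-just-injective _ _ (trans (sym eq′) just-map)) p)
    where
    just-map : padValuation ρ (map just ys) ≡ map just (map (lookup ρ) ys)
    just-map = trans (sym (map-∘ _ _ ys)) (map-∘ _ _ ys)
  ... | no ¬justs = mk⇔ (λ ())
    (λ (as , _ , eq) → ¬justs (map-map≡map-just _ (map (lookup σ) xs) as eq))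
  ⊨unpad σ (rel P♯ (x ∷ [])) ρ rewrite lookup-map x (Maybe.map (lookup ρ)) σ with lookup σ x
  ... | just _  = mk⇔ (λ ()) (λ ())
  ... | nothing = mk⇔ (λ _ → refl) (λ _ → id)
  ⊨unpad σ (x ≈ y) ρ
    rewrite lookup-map x (Maybe.map (lookup ρ)) σ | lookup-map y (Maybe.map (lookup ρ)) σ
    with lookup σ x | lookup σ y
  ... | just _  | just _  = mk⇔ (cong just) just-injective
  ... | just _  | nothing = mk⇔ (λ ()) (λ ())
  ... | nothing | just _  = mk⇔ (λ ()) (λ ())
  ... | nothing | nothing = mk⇔ (λ _ → refl) (λ _ → id)
  ⊨unpad σ false   ρ = ⇔-id _
  ⊨unpad σ (φ ∧ ψ) ρ = ⊨unpad σ φ ρ ×-⇔ ⊨unpad σ ψ ρ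
  ⊨unpad σ (φ ∨ ψ) ρ = ⊨unpad σ φ ρ ⊎-⇔ ⊨unpad σ ψ ρ
  ⊨unpad σ (φ ⇒ ψ) ρ = →-cong-⇔ (⊨unpad σ φ ρ) (⊨unpad σ ψ ρ)
  ⊨unpad σ (all φ) ρ = mk⇔
    (λ { (p , ps) nothing  → to (⊨unpad (nothing ∷ σ) φ ρ) p
       ; (p , ps) (just a) → to (⊨unpad-quantified σ φ ρ a) (ps a) })
    (λ p → from (⊨unpad (nothing ∷ σ) φ ρ) (p nothing)
         , λ a → from (⊨unpad-quantified σ φ ρ a) (p (just a)))
  ⊨unpad σ (ex φ) ρ = mk⇔
    (λ { (inj₁ p)       → nothing , to (⊨unpad (nothing ∷ σ) φ ρ) p
       ; (inj₂ (a , p)) → just a , to (⊨unpad-quantified σ φ ρ a) p })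
    (λ { (nothing , p) → inj₁ (from (⊨unpad (nothing ∷ σ) φ ρ) p)
       ; (just a , p)  → inj₂ (a , from (⊨unpad-quantified σ φ ρ a) p) })

  ⊨unpad-quantified σ φ ρ a =
    ≡⇒⇔ (cong (λ us → pad M ⊨ φ [ just a ∷ us ]) (padValuation-∷ a ρ σ))
      ⇔-∘ ⊨unpad (just zero ∷ map (Maybe.map suc) σ) φ (a ∷ ρ)

-- Symbolic automata

-- States are elements of some `Fin`, so a subset of `Fin m` is coded by a number below `2 ^ m`,
-- whose digits `finToFun` returns.
member : Fin (2 ^ m) → Fin m → Bool
member S i = bit (finToFun S i)
  where
  bit : Fin 2 → Bool
  bit zero    = Bool.false
  bit (suc _) = Bool.true

-- Every pair is the value of `remQuot` at its `combine`, so a quantifier over product states is one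
-- over pairs of states.
∃-remQuot : (P : Fin m × Fin n → Set) →
            (∃[ i ] P (remQuot n i)) ⇔ (∃[ p ] ∃[ q ] P (p , q))
∃-remQuot P = mk⇔
  (λ (i , x) → _ , _ , x)
  (λ (p , q , x) → combine p q , subst P (sym (Fin.remQuot-combine p q)) x)

-- Whether a state is initial or final is given by a sentence about the alphabet
-- structure, so that the constructions below need not know its theory.
record SymbolicAutomaton (L : Language) (n : ℕ) : Set where
  field
    size       : ℕ
    initial    : Fin size → Sentence (L ♯)
    transition : Fin size → Fin size → Formula (L ♯) n
    final      : Fin size → Sentence (L ♯)

open SymbolicAutomaton

universal : SymbolicAutomaton L n
universal = record
  { size = 1 ; initial = λ _ → true ; transition = λ _ _ → true ; final = λ _ → true }

empty : SymbolicAutomaton L n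
empty = record
  { size = 0 ; initial = λ () ; transition = λ () ; final = λ () }

equalTapes : Fin n → Fin n → SymbolicAutomaton L n
equalTapes x y = record
  { size = 1 ; initial = λ _ → true ; transition = λ _ _ → x ≈ y ; final = λ _ → true }

renameTapes : Vec (Fin m) n → SymbolicAutomaton L n → SymbolicAutomaton L m
renameTapes σ A = record
  { size       = size A
  ; initial    = initial A
  ; transition = λ p q → rename σ (transition A p q)
  ; final      = final A
  }

infixr 7 _⊗_

_⊗_ : SymbolicAutomaton L n → SymbolicAutomaton L n → SymbolicAutomaton L n
A ⊗ B = record
  { size       = size A * size B
  ; initial    = λ i → let p , q = split i in initial A p ∧ initial B q
  ; transition = λ i j → let p , q = split i ; r , s = split j
                         in transition A p r ∧ transition B q s
  ; final      = λ i → let p , q = split i in final A p ∧ final B q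
  }
  where split = remQuot {size A} (size B)

⨂ : (Fin m → SymbolicAutomaton L n) → SymbolicAutomaton L n
⨂ {m = zero}  A = universal
⨂ {m = suc m} A = A zero ⊗ ⨂ (A ∘ suc)

-- A subset state contains all the states reached by A but possibly more, so that an
-- accepting run still shows that no run of A is accepting.
∁ : SymbolicAutomaton L n → SymbolicAutomaton L n
∁ A = record
  { size       = 2 ^ size A
  ; initial    = λ S → ⋀ λ q → initial A q ⇒ ⌜ member S q ⌝
  ; transition = λ S S′ → ⋀ λ p → ⋀ λ q →
                 ⌜ member S p ⌝ ⇒ transition A p q ⇒ ⌜ member S′ q ⌝
  ; final      = λ S → ⋀ λ q → ⌜ member S q ⌝ ⇒ ~ final A q
  }

module _ (A : SymbolicAutomaton L (suc n)) where

  -- There is no constant for #, so the inner quantifier introduces it, pinned down by `P♯`, and all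
  -- tapes but the first are renamed to it. The outer variable is the letter on the projected tape.
  blankTransition : Fin (size A) → Fin (size A) → Sentence (L ♯)
  blankTransition p q =
    ex (ex (rel P♯ (zero ∷ []) ∧ rename (suc zero ∷ replicate n zero) (transition A p q)))

  -- Backward closure under blank transitions, starting from the final states. Which transitions
  -- exist depends on `M`, so reachability is not computed but expressed by a sentence for each of
  -- the finitely many subsets.
  Closed : Fin (2 ^ size A) → Sentence (L ♯)
  Closed S = (⋀ λ q → final A q ⇒ ⌜ member S q ⌝)
           ∧ (⋀ λ p → ⋀ λ q → blankTransition p q ⇒ ⌜ member S q ⌝ ⇒ ⌜ member S p ⌝)

  -- The projected tape may be longer than all the others.  The states from which A can
  -- reach a final state while the other tapes are blank form the least closed set.
  project : SymbolicAutomaton L n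
  project = record
    { size       = size A
    ; initial    = initial A
    ; transition = λ p q → ex (transition A p q)
    ; final      = λ q → ⋀ λ S → Closed S ⇒ ⌜ member S q ⌝
    }

-- Words accepted by symbolic automata

Letter : Structure L → ℕ → Set
Letter M n = Vec (Maybe (Carrier M)) n

blanks : {A : Set} → ℕ → List (Vec (Maybe A) n)
blanks {n = n} k = List.replicate k (replicate n nothing)

module _ (M : Structure L) where

  AcceptsFrom : (A : SymbolicAutomaton L n) → Fin (size A) → List (Letter M n) → Set
  AcceptsFrom A q []       = pad M ⊨ final A q [ [] ]
  AcceptsFrom A q (u ∷ us) =
    ∃[ r ] pad M ⊨ transition A q r [ u ] × AcceptsFrom A r us

  AcceptsWord : SymbolicAutomaton L n → List (Letter M n) → Set
  AcceptsWord A us = ∃[ q ] pad M ⊨ initial A q [ [] ] × AcceptsFrom A q us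

  universal-accepts : (us : List (Letter M n)) → AcceptsWord universal us
  universal-accepts us = zero , id , from-zero us
    where
    from-zero : (us : List (Letter M n)) → AcceptsFrom universal zero us
    from-zero []       = id
    from-zero (u ∷ us) = zero , id , from-zero us

  accepts-rename : (σ : Vec (Fin m) n) (A : SymbolicAutomaton L n) (us : List (Letter M m)) →
    AcceptsWord (renameTapes σ A) us ⇔
    AcceptsWord A (List.map (λ u → map (lookup u) σ) us)
  accepts-rename σ A us = ∃-⇔ λ q → ⇔-id _ ×-⇔ from-state q us
    where
    from-state : ∀ q us → AcceptsFrom (renameTapes σ A) q us ⇔
                 AcceptsFrom A q (List.map (λ u → map (lookup u) σ) us)
    from-state q []       = ⇔-id _
    from-state q (u ∷ us) =
      ∃-⇔ λ r → ⊨rename (pad M) σ (transition A q r) u ×-⇔ from-state r us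

  accepts-⊗ : (A B : SymbolicAutomaton L n) (us : List (Letter M n)) →
    AcceptsWord (A ⊗ B) us ⇔ (AcceptsWord A us × AcceptsWord B us)
  accepts-⊗ A B us = interchange
    ⇔-∘ ∃-remQuot (λ (p , q) → (pad M ⊨ initial A p [ [] ] × pad M ⊨ initial B q [ [] ])
                                × (AcceptsFrom A p us × AcceptsFrom B q us))
    ⇔-∘ ∃-⇔ λ i → ⇔-id _ ×-⇔ from-state i us
    where
    interchange : {S S′ : Set} {P Q : S → Set} {P′ Q′ : S′ → Set} →
      (∃[ p ] ∃[ q ] (P p × P′ q) × (Q p × Q′ q)) ⇔ ((∃[ p ] P p × Q p) × (∃[ q ] P′ q × Q′ q))
    interchange = mk⇔
      (λ (p , q , (a , b) , (c , d)) → (p , a , c) , (q , b , d))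
      (λ ((p , a , c) , (q , b , d)) → p , q , (a , b) , (c , d))

    from-state : ∀ i us → let p , q = remQuot {size A} (size B) i in
                 AcceptsFrom (A ⊗ B) i us ⇔ (AcceptsFrom A p us × AcceptsFrom B q us)
    from-state i []       = ⇔-id _
    from-state i (u ∷ us) = interchange
      ⇔-∘ ∃-remQuot (λ (r , s) → (pad M ⊨ transition A _ r [ u ] × pad M ⊨ transition B _ s [ u ])
                                  × (AcceptsFrom A r us × AcceptsFrom B s us))
      ⇔-∘ ∃-⇔ λ j → ⇔-id _ ×-⇔ from-state j us

  accepts-⨂ : (A : Fin m → SymbolicAutomaton L n) (us : List (Letter M n)) →
    AcceptsWord (⨂ A) us ⇔ (∀ i → AcceptsWord (A i) us)
  accepts-⨂ {m = zero}  A us = mk⇔ (λ _ ()) (λ _ → universal-accepts us)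
  accepts-⨂ {m = suc m} A us = mk⇔
    (λ a → λ { zero    → proj₁ (to split a)
             ; (suc i) → to (accepts-⨂ (A ∘ suc) us) (proj₂ (to split a)) i })
    (λ a → from split (a zero , from (accepts-⨂ (A ∘ suc) us) (a ∘ suc)))
    where split = accepts-⊗ (A zero) (⨂ (A ∘ suc)) us

  ⊨blankTransition : (A : SymbolicAutomaton L (suc n)) → ∀ p q →
    pad M ⊨ blankTransition A p q [ [] ] ⇔
    (∃[ a ] pad M ⊨ transition A p q [ a ∷ replicate n nothing ])
  ⊨blankTransition {n} A p q = ∃-⇔ λ a → mk⇔
    (λ { (_ , refl , t) → subst (pad M ⊨ transition A p q [_]) (valuation a) (to (renamed a) t) })
    (λ t → nothing , refl ,
      from (renamed a) (subst (pad M ⊨ transition A p q [_]) (sym (valuation a)) t))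
    where
    σ = suc zero ∷ replicate n zero

    valuation : ∀ a → map (lookup (nothing ∷ a ∷ [])) σ ≡ a ∷ replicate n nothing
    valuation a = cong (a ∷_) (map-replicate (lookup (nothing ∷ a ∷ [])) zero n)

    renamed : ∀ a → pad M ⊨ rename σ (transition A p q) [ nothing ∷ a ∷ [] ] ⇔
              pad M ⊨ transition A p q [ map (lookup (nothing ∷ a ∷ [])) σ ]
    renamed a = ⊨rename (pad M) σ (transition A p q) (nothing ∷ a ∷ [])

  module _ (em : ExcludedMiddle 0ℓ) where

    -- Excluded middle codes an arbitrary predicate on states. Such codes serve as witnesses in
    -- correctness proofs and never enter the construction of a symbolic automaton.
    subset : (Fin m → Set) → Fin (2 ^ m)
    subset P = funToFin λ i → if does (em {P i}) then suc zero else zero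

    member-subset : (P : Fin m → Set) (i : Fin m) → T (member (subset P) i) ⇔ P i
    member-subset P i
      rewrite Fin.finToFun-funToFin (λ i → if does (em {P i}) then suc (zero {0}) else zero) i
      with em {P i}
    ... | yes p = mk⇔ (λ _ → p) _
    ... | no ¬p = mk⇔ (λ ()) ¬p

    -- An accepting run of `∁ A` can be chosen by looking ahead: at each position take the set of
    -- states from which `A` rejects the rest of the word. A transition from a state rejecting
    -- `u ∷ us` on `u` leads to a state rejecting `us`, so these sets form a run. Conversely, every
    -- state reached by `A` lies in the current subset, so it is not final at the end.
    accepts-∁ : (A : SymbolicAutomaton L n) (us : List (Letter M n)) →
      AcceptsWord (∁ A) us ⇔ (¬ AcceptsWord A us)
    accepts-∁ A us = mk⇔
      (λ (S , i , a) (q , j , b) →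
        to (from-state S us) a q (to (⊨⌜⌝ (pad M) _) (to (⊨⋀ (pad M) _) i q j)) b)
      (λ ¬a → let S , S-rejects = rejecting us in
        S , from (⊨⋀ (pad M) _)
              (λ q i → from (⊨⌜⌝ (pad M) _) (from (S-rejects q) λ a → ¬a (q , i , a)))
          , from (from-state S us) (λ q → to (S-rejects q)))
      where
      rejecting : ∀ us → ∃[ S ] (∀ q → T (member S q) ⇔ (¬ AcceptsFrom A q us))
      rejecting us = subset Rejects , member-subset Rejects
        where Rejects = λ q → ¬ AcceptsFrom A q us

      from-state : ∀ S us → AcceptsFrom (∁ A) S us ⇔
                   (∀ q → T (member S q) → ¬ AcceptsFrom A q us)
      from-state S [] = (∀-⇔ λ q → →-cong-⇔ (⊨⌜⌝ (pad M) _) (⇔-id _)) ⇔-∘ ⊨⋀ (pad M) _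
      from-state S (u ∷ us) = mk⇔
        (λ (S′ , t , a) p p∈S (q , t′ , b) → to (from-state S′ us) a q
          (to (⊨⌜⌝ (pad M) _)
            (to (⊨⋀ (pad M) _) (to (⊨⋀ (pad M) _) t p) q (from (⊨⌜⌝ (pad M) _) p∈S) t′)) b)
        (λ ¬a → let S′ , S′-rejects = rejecting us in
          S′ , from (⊨⋀ (pad M) _) (λ p → from (⊨⋀ (pad M) _) λ q p∈S t → from (⊨⌜⌝ (pad M) _)
                 (from (S′-rejects q) λ b → ¬a p (to (⊨⌜⌝ (pad M) _) p∈S) (q , t , b)))
             , from (from-state S′ us) (λ q → to (S′-rejects q)))

    -- While the visible word lasts, the missing letter is guessed at each step. The rest of a
    -- longer guessed tape is read against blanks, and this is absorbed in the choice of final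
    -- states.
    accepts-project : (A : SymbolicAutomaton L (suc n)) (us : List (Letter M n)) →
      AcceptsWord (project A) us ⇔
      (∃[ vs ] (∃[ k ] List.map Vec.tail vs ≡ us ++ blanks k) × AcceptsWord A vs)
    accepts-project {n} A us = mk⇔
      (λ (q , i , a) → let vs , eq , b = to (from-state q us) a in vs , eq , q , i , b)
      (λ (vs , eq , q , i , b) → q , i , from (from-state q us) (vs , eq , b))
      where
      Lifts : Fin (size A) → List (Letter M n) → Set
      Lifts q us = ∃[ vs ] (∃[ k ] List.map Vec.tail vs ≡ us ++ blanks k) × AcceptsFrom A q vs

      -- A final state of the projection lies in every closed set. The set of states with the
      -- desired run on blanks is closed, since such a run can be prolonged at its start.
      final⇒lifts : ∀ q → pad M ⊨ final (project A) q [ [] ] → Lifts q []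
      final⇒lifts q h = to (member-subset R q) (to (⊨⌜⌝ (pad M) _) (to (⊨⋀ (pad M) _) h S closed))
        where
        R = λ q → Lifts q []
        S = subset R

        closed : pad M ⊨ Closed A S [ [] ]
        closed =
          from (⊨⋀ (pad M) _) (λ q f →
            from (⊨⌜⌝ (pad M) _) (from (member-subset R q) ([] , (0 , refl) , f))) ,
          from (⊨⋀ (pad M) _) (λ p → from (⊨⋀ (pad M) _) λ q t q∈S →
            let a , t′ = to (⊨blankTransition A p q) t
                vs , (k , eq) , b = to (member-subset R q) (to (⊨⌜⌝ (pad M) _) q∈S)
            in from (⊨⌜⌝ (pad M) _) (from (member-subset R p)
                 (_ ∷ vs , (suc k , cong (_ ∷_) eq) , q , t′ , b)))

      lifts⇒final : ∀ q vs k → List.map Vec.tail vs ≡ blanks k → AcceptsFrom A q vs →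
                    pad M ⊨ final (project A) q [ [] ]
      lifts⇒final q vs k eq b =
        from (⊨⋀ (pad M) λ S → Closed A S ⇒ ⌜ member S q ⌝) λ S (c , c′) → from (⊨⌜⌝ (pad M) _)
        (in-closed S (λ q → to (⊨⌜⌝ (pad M) _) ∘ to (⊨⋀ (pad M) _) c q)
          (λ p q t → to (⊨⌜⌝ (pad M) _) ∘ to (⊨⋀ (pad M) _) (to (⊨⋀ (pad M) _) c′ p) q
                       (from (⊨blankTransition A p q) t) ∘ from (⊨⌜⌝ (pad M) _))
          q vs k eq b)
        where
        -- Going back along a run on blanks, membership in `S` passes from its final state to its
        -- first state.
        in-closed : ∀ S → (∀ q → pad M ⊨ final A q [ [] ] → T (member S q)) →
          (∀ p q → (∃[ a ] pad M ⊨ transition A p q [ a ∷ replicate n nothing ]) →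
            T (member S q) → T (member S p)) →
          ∀ q vs k → List.map Vec.tail vs ≡ blanks k → AcceptsFrom A q vs → T (member S q)
        in-closed S c c′ q []             _       _  b           = c q b
        in-closed S c c′ q ((a ∷ _) ∷ vs) (suc k) eq (r , t , b) with refl , eq′ ← ∷-injective eq =
          c′ q r (a , t) (in-closed S c c′ r vs k eq′ b)

      from-state : ∀ q us → AcceptsFrom (project A) q us ⇔ Lifts q us
      from-state q []       = mk⇔ (final⇒lifts q) (λ (vs , (k , eq) , b) → lifts⇒final q vs k eq b)
      from-state q (u ∷ us) = mk⇔
        (λ (r , (a , t) , b) → let vs , (k , eq) , c = to (from-state r us) b in
          (a ∷ u) ∷ vs , (k , cong (u ∷_) eq) , r , t , c)
        lifts⇒
        where
        lifts⇒ : Lifts q (u ∷ us) → AcceptsFrom (project A) q (u ∷ us)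
        lifts⇒ ((a ∷ _) ∷ vs , (k , eq) , r , t , c) with refl , eq′ ← ∷-injective eq =
          r , (a , t) , from (from-state r us) (vs , (k , eq′) , c)

-- From symbolic to ordinary automata

module _ (M : Structure L) (em : ExcludedMiddle 0ℓ) (A : SymbolicAutomaton L n) where
  decide : (P : Fin (size A) → Set) → Subset.Subset (size A)
  decide P = tabulate λ q → does (em {P q})

  ∈-decide : (P : Fin (size A) → Set) (q : Fin (size A)) → q Subset.∈ decide P ⇔ P q
  ∈-decide P q = T-does em ⇔-∘ ≡⇒⇔ (cong T (lookup∘tabulate _ q)) ⇔-∘ ⇔-sym (T-lookup (decide P) q)

  -- All pairs of states get a transition, even if its formula is unsatisfiable. Only the sentences
  -- for initial and final states have to be decided.
  realize : Automaton L n
  realize = record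
    { size        = size A
    ; transitions = List.map (λ (p , q) → p , transition A p q , q) (cartesianProduct states states)
    ; initial     = decide λ q → pad M ⊨ initial A q [ [] ]
    ; terminal    = decide λ q → pad M ⊨ final A q [ [] ]
    }
    where states = allFin (size A)

  accepts-realize : (ws : Vec (List (Carrier M)) n) →
                    ws ∈ Accepts M realize ⇔ AcceptsWord M A ⟨ ws ⟩
  accepts-realize ws = mk⇔
    (λ (p , q , i , t , run) → p , to (∈-decide _ p) i , run⇒accepts run t)
    (λ (p , i , a) → let q , t , run = accepts⇒run p _ a in p , q , from (∈-decide _ p) i , t , run)
    where
    Final : Fin (size A) → Set
    Final q = q Subset.∈ Automaton.terminal realize

    run⇒accepts : ∀ {p us q} → Run M realize p us q → Final q → AcceptsFrom M A p us
    run⇒accepts []              t = to (∈-decide _ _) t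
    run⇒accepts (step e h run) t with _ , _ , refl ← ∈-map⁻ _ e = _ , h , run⇒accepts run t

    accepts⇒run : ∀ p us → AcceptsFrom M A p us → ∃[ q ] Final q × Run M realize p us q
    accepts⇒run p []       t           = p , from (∈-decide _ p) t , []
    accepts⇒run p (u ∷ us) (r , h , a) = let q , t , run = accepts⇒run r us a in
      q , t , step (∈-map⁺ _ (∈-cartesianProduct⁺ (∈-allFin p) (∈-allFin r))) h run

-- Removing the padding at the end of a word

NonBlank : Pred (Vec (Maybe A) n) 0ℓ
NonBlank u = u ≢ replicate _ nothing

-- The trimmed word contains no blank letter, so it ends exactly where the blanks begin.
trim-unique : (us vs : List (Vec (Maybe A) n)) (k l : ℕ) → All NonBlank us → All NonBlank vs →
              us ++ blanks k ≡ vs ++ blanks l → us ≡ vs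
trim-unique []       []       k       l       _       _       _  = refl
trim-unique []       (v ∷ vs) (suc k) l       _       (p ∷ _) eq =
  contradiction (sym (proj₁ (∷-injective eq))) p
trim-unique (u ∷ us) []       k       (suc l) (p ∷ _) _       eq =
  contradiction (proj₁ (∷-injective eq)) p
trim-unique (u ∷ us) (v ∷ vs) k       l       (_ ∷ p) (_ ∷ q) eq =
  let u≡v , eq′ = ∷-injective eq in cong₂ _∷_ u≡v (trim-unique us vs k l p q eq′)

-- From ordinary to symbolic automata, allowing trailing blanks

blank : Formula (L ♯) n
blank = ⋀ λ i → rel P♯ (i ∷ [])

⊨blank : (M : Structure L) (u : Letter M n) →
         pad M ⊨ blank [ u ] ⇔ u ≡ replicate n nothing
⊨blank {n = n} M u = mk⇔
  (λ p → trans (sym (tabulate∘lookup u))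
    (trans (tabulate-cong λ i → trans (to (⊨⋀ (pad M) _) p i) (sym (lookup-replicate i nothing)))
           (tabulate∘lookup (replicate n nothing))))
  (λ { refl → from (⊨⋀ (pad M) {n} λ i → rel P♯ (i ∷ [])) λ i → lookup-replicate i nothing })

module _ {S : ℕ} where

  -- A symbolic automaton has one formula for each pair of states, so parallel transitions are
  -- joined in a disjunction. Entries with other end points contribute a false disjunct.
  edge : List (Fin S × Formula (L ♯) n × Fin S) → Fin S → Fin S → Formula (L ♯) n
  edge []                  p q = false
  edge ((p′ , φ , q′) ∷ E) p q =
    (⌜ does (p′ Fin.≟ p) ⌝ ∧ ⌜ does (q′ Fin.≟ q) ⌝ ∧ φ) ∨ edge E p q

  ⊨edge : (M : Structure L) (E : List (Fin S × Formula (L ♯) n × Fin S)) → ∀ p q u →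
          pad M ⊨ edge E p q [ u ] ⇔ (∃[ φ ] (p , φ , q) ∈ₗ E × pad M ⊨ φ [ u ])
  ⊨edge M []                    p q u = mk⇔ (λ ()) (λ { (_ , () , _) })
  ⊨edge M ((p′ , φ , q′) ∷ E) p q u = mk⇔
    (λ { (inj₁ (e , e′ , h)) →
        φ , here (cong₂ (λ p q → p , φ , q) (guard p′ p e) (guard q′ q e′)) , h
       ; (inj₂ h) → let ψ , e , h′ = to (⊨edge M E p q u) h in ψ , there e , h′ })
    (λ { (_ , here refl , h) → inj₁ (unguard p , unguard q , h)
       ; (ψ , there e , h)   → inj₂ (from (⊨edge M E p q u) (ψ , e , h)) })
    where
    guard : ∀ p′ p → pad M ⊨ ⌜ does (p′ Fin.≟ p) ⌝ [ u ] → p ≡ p′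
    guard p′ p = sym ∘ to (T-does (p′ Fin.≟ p)) ∘ to (⊨⌜⌝ (pad M) _)

    unguard : ∀ p → pad M ⊨ ⌜ does (p Fin.≟ p) ⌝ [ u ]
    unguard p = from (⊨⌜⌝ (pad M) _) (from (T-does (p Fin.≟ p)) refl)

-- The new state zero is entered when the input has ended and only # is left.
saturate : Automaton L n → SymbolicAutomaton L n
saturate {L} {n} A = record
  { size       = suc 𝓐.size
  ; initial    = λ { zero → false ; (suc p) → ⌜ lookup 𝓐.initial p ⌝ }
  ; transition = move
  ; final      = λ { zero → true ; (suc p) → ⌜ lookup 𝓐.terminal p ⌝ }
  }
  where
  module 𝓐 = Automaton A

  move : Fin (suc 𝓐.size) → Fin (suc 𝓐.size) → Formula (L ♯) n
  move zero    zero    = blank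
  move zero    (suc q) = false
  move (suc p) zero    = ⌜ lookup 𝓐.terminal p ⌝ ∧ blank
  -- Some transitions of `A` may be satisfied by the blank letter. They must not fire on added
  -- padding, and a convolution contains no blank letter.
  move (suc p) (suc q) = ~ blank ∧ edge 𝓐.transitions p q

module _ (M : Structure L) (A : Automaton L n) where
  private module 𝓐 = Automaton A

  AcceptsTrimmed : 𝓐.State → List (Letter M n) → Set
  AcceptsTrimmed p us =
    ∃[ vs ] (∃[ k ] us ≡ vs ++ blanks k) × All NonBlank vs ×
    ∃[ q ] q Subset.∈ 𝓐.terminal × Run M A p vs q

  accepts-saturate : (us : List (Letter M n)) →
    AcceptsWord M (saturate A) us ⇔ (∃[ p ] p Subset.∈ 𝓐.initial × AcceptsTrimmed p us)
  accepts-saturate us = mk⇔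
    (λ { (suc p , i , a) → p , to (T-lookup 𝓐.initial p) (to (⊨⌜⌝ (pad M) _) i) , trim p us a })
    (λ (p , i , a) → suc p , from (⊨⌜⌝ (pad M) _) (from (T-lookup 𝓐.initial p) i) , untrim p us a)
    where
    terminal⇒ : ∀ {n p} {ρ : Letter M n} →
                pad M ⊨ ⌜ lookup 𝓐.terminal p ⌝ [ ρ ] → p Subset.∈ 𝓐.terminal
    terminal⇒ = to (T-lookup 𝓐.terminal _) ∘ to (⊨⌜⌝ (pad M) _)

    terminal⇐ : ∀ {n p} {ρ : Letter M n} →
                p Subset.∈ 𝓐.terminal → pad M ⊨ ⌜ lookup 𝓐.terminal p ⌝ [ ρ ]
    terminal⇐ = from (⊨⌜⌝ (pad M) _) ∘ from (T-lookup 𝓐.terminal _)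

    ⊨blank-blank : pad M ⊨ blank [ replicate n nothing ]
    ⊨blank-blank = from (⊨blank M (replicate n nothing)) refl

    from-zero : ∀ us → AcceptsFrom M (saturate A) zero us → ∃[ k ] us ≡ blanks k
    from-zero []       _              = 0 , refl
    from-zero (u ∷ us) (zero , b , a) =
      let k , eq = from-zero us a in suc k , cong₂ _∷_ (to (⊨blank M u) b) eq

    zero-accepts : ∀ k → AcceptsFrom M (saturate A) zero (blanks k)
    zero-accepts zero    = id
    zero-accepts (suc k) = zero , ⊨blank-blank , zero-accepts k

    trim : ∀ p us → AcceptsFrom M (saturate A) (suc p) us → AcceptsTrimmed p us
    trim p [] t = [] , (0 , refl) , [] , p , terminal⇒ t , []
    trim p (u ∷ us) (zero , (t , b) , a) =
      let k , eq = from-zero us a in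
      [] , (suc k , cong₂ _∷_ (to (⊨blank M u) b) eq) , [] ,
      p , terminal⇒ t , []
    trim p (u ∷ us) (suc q , (¬b , e) , a) =
      let vs , (k , eq) , nb , r , t , run = trim q us a
          φ , e∈ , h = to (⊨edge M 𝓐.transitions p q u) e
      in u ∷ vs , (k , cong (u ∷_) eq) , (¬b ∘ from (⊨blank M u)) ∷ nb , r , t , step e∈ h run

    untrim : ∀ p us → AcceptsTrimmed p us → AcceptsFrom M (saturate A) (suc p) us
    untrim p _ ([] , (zero , refl) , _ , .p , t , []) =
      terminal⇐ t
    untrim p _ ([] , (suc k , refl) , _ , .p , t , []) =
      zero , (terminal⇐ t , ⊨blank-blank) , zero-accepts k
    untrim p _ (u ∷ vs , (k , refl) , ¬b ∷ nb , r , t , step e h run) =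
      suc _ , (¬b ∘ to (⊨blank M u) , from (⊨edge M 𝓐.transitions p _ u) (_ , e , h)) ,
      untrim _ _ (vs , (k , refl) , nb , r , t , run)

-- Convolution

-- The convolution with a length of choice: a quantified tape may be longer than the others, so
-- automata have to be correct at every sufficient length.
parallel : ℕ → Vec (List A) n → List (Vec (Maybe A) n)
parallel m ws = applyUpTo (λ i → map (letter i) ws) m

Bounded : ℕ → Vec (List A) n → Set
Bounded m ws = ∀ i → length (lookup ws i) ≤ m

maxLength : Vec (List A) n → ℕ
maxLength ws = foldr′ _⊔_ 0 (map length ws)

maxLength-bounds : (ws : Vec (List A) n) → Bounded (maxLength ws) ws
maxLength-bounds (w ∷ ws) zero    = ℕ.m≤m⊔n _ _
maxLength-bounds (w ∷ ws) (suc i) = ℕ.≤-trans (maxLength-bounds ws i) (ℕ.m≤n⊔m _ _)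

maxLength-least : (ws : Vec (List A) n) → Bounded m ws → maxLength ws ≤ m
maxLength-least []       _ = z≤n
maxLength-least (w ∷ ws) b = ℕ.⊔-lub (b zero) (maxLength-least ws (b ∘ suc))

-- The maximum is attained by one of the words. This is why no letter of `⟨ ws ⟩` is blank.
<maxLength⇒<length : (ws : Vec (List A) n) {i : ℕ} → i < maxLength ws →
                     ∃[ j ] i < length (lookup ws j)
<maxLength⇒<length (w ∷ ws) {i} i< with ℕ.⊔-sel (length w) (maxLength ws)
... | inj₁ eq = zero , subst (i <_) eq i<
... | inj₂ eq = let j , i<′ = <maxLength⇒<length ws (subst (i <_) eq i<) in suc j , i<′

letter-beyond : (w : List A) {i : ℕ} → length w ≤ i → letter i w ≡ nothing
letter-beyond []      {zero}  _       = refl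
letter-beyond []      {suc i} _       = refl
letter-beyond (a ∷ w)         (s≤s l) = letter-beyond w l

letter-within : (w : List A) {i : ℕ} → i < length w → letter i w ≢ nothing
letter-within (a ∷ w) {zero}  _       ()
letter-within (a ∷ w) {suc i} (s<s l) = letter-within w l

-- Both words lie within the first `m` positions, and where the shorter one ends the other would
-- still have a letter.
letter-injective : (w w′ : List A) → length w ≤ m → length w′ ≤ m →
                   (∀ {i} → i < m → letter i w ≡ letter i w′) → w ≡ w′
letter-injective []      []        _       _        _  = refl
letter-injective []      (_ ∷ _)   _       (s≤s _)  eq with () ← eq ℕ.0<1+n
letter-injective (_ ∷ _) []        (s≤s _) _        eq with () ← eq ℕ.0<1+n
letter-injective (a ∷ w) (a′ ∷ w′) (s≤s l) (s≤s l′) eq =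
  cong₂ _∷_ (just-injective (eq ℕ.0<1+n)) (letter-injective w w′ l l′ (eq ∘ s<s))

applyUpTo-cong : {f g : ℕ → A} → (∀ i → f i ≡ g i) → ∀ m → applyUpTo f m ≡ applyUpTo g m
applyUpTo-cong f≗g zero    = refl
applyUpTo-cong f≗g (suc m) = cong₂ _∷_ (f≗g 0) (applyUpTo-cong (f≗g ∘ suc) m)

applyUpTo-++-replicate : (f : ℕ → A) (c : A) (m k : ℕ) → (∀ {i} → m ≤ i → f i ≡ c) →
                         applyUpTo f (m + k) ≡ applyUpTo f m ++ List.replicate k c
applyUpTo-++-replicate f c zero    zero    h = refl
applyUpTo-++-replicate f c zero    (suc k) h =
  cong₂ _∷_ (h z≤n) (applyUpTo-++-replicate (f ∘ suc) c zero k (λ _ → h z≤n))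
applyUpTo-++-replicate f c (suc m) k       h =
  cong (f 0 ∷_) (applyUpTo-++-replicate (f ∘ suc) c m k (h ∘ s≤s))

map-letter-beyond : (ws : Vec (List A) n) {i : ℕ} → Bounded i ws →
                    map (letter i) ws ≡ replicate n nothing
map-letter-beyond []       b = refl
map-letter-beyond (w ∷ ws) b = cong₂ _∷_ (letter-beyond w (b zero)) (map-letter-beyond ws (b ∘ suc))

Bounded-≤ : {ws : Vec (List A) n} → m ≤ k → Bounded m ws → Bounded k ws
Bounded-≤ m≤k b i = ℕ.≤-trans (b i) m≤k

parallel-blanks : (ws : Vec (List A) n) → Bounded m ws → ∀ k →
                  parallel (m + k) ws ≡ parallel m ws ++ blanks k
parallel-blanks {m = m} ws b k = applyUpTo-++-replicate _ _ m k λ m≤i →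
  map-letter-beyond ws (Bounded-≤ {ws = ws} m≤i b)

⟨⟩-nonBlank : (ws : Vec (List A) n) → All NonBlank ⟨ ws ⟩
⟨⟩-nonBlank ws = All.applyUpTo⁺₁ _ _ λ {i} i< eq →
  let j , i<′ = <maxLength⇒<length ws i< in
  letter-within (lookup ws j) i<′
    (trans (sym (lookup-map j (letter i) ws))
      (trans (cong (λ u → lookup u j) eq) (lookup-replicate j nothing)))

parallel-trim : (ws : Vec (List A) n) → Bounded m ws → ∃[ k ] parallel m ws ≡ ⟨ ws ⟩ ++ blanks k
parallel-trim {m = m} ws b = m ∸ maxLength ws ,
  trans (cong (λ l → parallel l ws) (sym (ℕ.m+[n∸m]≡n (maxLength-least ws b))))
        (parallel-blanks ws (maxLength-bounds ws) _)

parallel-rename : (σ : Vec (Fin k) n) (ws : Vec (List A) k) (m : ℕ) →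
  List.map (λ u → map (lookup u) σ) (parallel m ws) ≡ parallel m (map (lookup ws) σ)
parallel-rename σ ws m = trans (map-applyUpTo _ _ m)
  (applyUpTo-cong (λ i → map-lookup-map (letter i) ws σ) m)

Bounded-rename : (σ : Vec (Fin k) n) (ws : Vec (List A) k) →
                 Bounded m ws → Bounded m (map (lookup ws) σ)
Bounded-rename σ ws b i =
  subst (λ w → length w ≤ _) (sym (lookup-map i (lookup ws) σ)) (b (lookup σ i))

-- Reassembles a parallel word from its first tape and the remaining ones, as needed to recognize a
-- guessed tape next to the given ones.
applyUpTo-∷ : (f : ℕ → A) (g : ℕ → Vec A n) (m : ℕ) (us : List (Vec A (suc n))) →
  List.map (λ u → Vec.[ lookup u zero ]) us ≡ applyUpTo (λ i → Vec.[ f i ]) m →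
  List.map Vec.tail us ≡ applyUpTo g m → us ≡ applyUpTo (λ i → f i ∷ g i) m
applyUpTo-∷ f g zero    []             _  _  = refl
applyUpTo-∷ f g (suc m) ((a ∷ u) ∷ us) e e′ =
  let h , t = ∷-injective e ; h′ , t′ = ∷-injective e′ in
  cong₂ _∷_ (cong₂ _∷_ (cong Vec.head h) h′) (applyUpTo-∷ (f ∘ suc) (g ∘ suc) m us t t′)

-- On a single tape a nonblank letter is a letter of the alphabet, so `vs` spells a word. With more
-- tapes, one of them could resume after a #.
trimmed-word : (vs : List (Vec (Maybe A) 1)) (k : ℕ) → All NonBlank vs →
  let us = vs ++ blanks k in
  ∃[ w ] length w ≤ length us × us ≡ parallel (length us) (w ∷ [])
trimmed-word []                    k       _         = [] , z≤n ,
  trans (sym (parallel-blanks ([] ∷ []) (λ { zero → z≤n }) k))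
        (cong (λ l → parallel l ([] ∷ [])) (sym (length-replicate k)))
trimmed-word ((nothing ∷ []) ∷ vs) k       (nb ∷ _)  = contradiction refl nb
trimmed-word ((just a ∷ []) ∷ vs)  k       (_ ∷ nbs) =
  let w , l , eq = trimmed-word vs k nbs in a ∷ w , s≤s l , cong ((just a ∷ []) ∷_) eq

module _ (M : Structure L) (A : Automaton L n) where

  -- By uniqueness of trimming, the word on which `A` runs is `⟨ ws ⟩`.
  accepts-saturate-parallel : (ws : Vec (List (Carrier M)) n) → Bounded m ws →
    AcceptsWord M (saturate A) (parallel m ws) ⇔ ws ∈ Accepts M A
  accepts-saturate-parallel {m} ws b = mk⇔
    (λ a → let p , i , vs , (k , eq) , nb , q , t , run = to (accepts-saturate M A _) a in
      p , q , i , t , subst (λ us → Run M A p us q)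
        (trim-unique vs ⟨ ws ⟩ k _ nb (⟨⟩-nonBlank ws)
          (trans (sym eq) (proj₂ (parallel-trim ws b)))) run)
    (λ (p , q , i , t , run) → from (accepts-saturate M A _)
      (p , i , ⟨ ws ⟩ , parallel-trim ws b , ⟨⟩-nonBlank ws , q , t , run))

-- From formulas to automata

module _ (M : Structure L) where

  accepts-equalTapes : (x y : Fin n) (us : List (Letter M n)) →
    AcceptsWord M (equalTapes x y) us ⇔ All (λ u → lookup u x ≡ lookup u y) us
  accepts-equalTapes x y us = mk⇔
    (λ { (zero , _ , a) → to (from-zero us) a })
    (λ a → zero , id , from (from-zero us) a)
    where
    from-zero : ∀ us →
                AcceptsFrom M (equalTapes x y) zero us ⇔ All (λ u → lookup u x ≡ lookup u y) us
    from-zero []       = mk⇔ (λ _ → []) (λ _ → id)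
    from-zero (u ∷ us) = mk⇔
      (λ { (zero , e , a) → e ∷ to (from-zero us) a })
      (λ { (e ∷ a) → zero , e , from (from-zero us) a })

  accepts-equalTapes-parallel : (x y : Fin n) (ws : Vec (List (Carrier M)) n) → Bounded m ws →
    AcceptsWord M (equalTapes x y) (parallel m ws) ⇔ lookup ws x ≡ lookup ws y
  accepts-equalTapes-parallel {m = m} x y ws b = mk⇔
    (λ a → letter-injective (lookup ws x) (lookup ws y) (b x) (b y) λ {i} i<m →
      trans (sym (lookup-map x (letter i) ws))
        (trans (All.applyUpTo⁻ _ m (to (accepts-equalTapes x y _) a) i<m)
               (lookup-map y (letter i) ws)))
    (λ eq → from (accepts-equalTapes x y _) (All.applyUpTo⁺₂ _ m λ i →
      trans (lookup-map x (letter i) ws)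
        (trans (cong (letter i) eq) (sym (lookup-map y (letter i) ws)))))

  -- A guessed tape could contain letters after a #. Saturated automata reject such tapes, so
  -- acceptance yields a genuine padded word.
  accepts-saturate-single : (D : Automaton L 1) (us : List (Letter M 1)) →
    AcceptsWord M (saturate D) us →
    ∃[ w ] length w ≤ length us × us ≡ parallel (length us) (w ∷ []) × (w ∷ []) ∈ Accepts M D
  accepts-saturate-single D us a with to (accepts-saturate M D us) a
  ... | _ , _ , vs , (k , refl) , nb , _ =
    let w , l , eq = trimmed-word vs k nb
    in w , l , eq , to (accepts-saturate-parallel M D (w ∷ []) λ { zero → l })
                       (subst (AcceptsWord M (saturate D)) eq a)

module _ (M : Structure L) (N : Structure K) (μ : Carrier N → List (Carrier M))
         (N-automatic : AutomaticVia M N μ) where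
  open AutomaticVia N-automatic

  -- Quantifiers of `N` range over codes and not over all words, so each quantified tape is checked
  -- for membership in the image of `μ`.
  domainOn : Fin n → SymbolicAutomaton L n
  domainOn i = renameTapes (i ∷ []) (saturate (proj₁ domain))

  -- The result is meant to be correct only on padded codes of tuples: `∁` and `equalTapes` also
  -- accept other words. Disjunction, implication and `all` are reduced classically to conjunction,
  -- negation and `ex`.
  compile : Formula K n → SymbolicAutomaton L n
  compile (rel R xs) = renameTapes xs (saturate (proj₁ (relations R)))
  compile (x ≈ y)    = equalTapes x y
  compile false      = empty
  compile (φ ∧ ψ)    = compile φ ⊗ compile ψ
  compile (φ ∨ ψ)    = ∁ (∁ (compile φ) ⊗ ∁ (compile ψ))
  compile (φ ⇒ ψ)    = ∁ (compile φ ⊗ ∁ (compile ψ))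
  compile (all φ)    = ∁ (project (domainOn zero ⊗ ∁ (compile φ)))
  compile (ex φ)     = project (domainOn zero ⊗ compile φ)

  accepts-domainOn : (i : Fin n) (ws : Vec (List (Carrier M)) n) → Bounded m ws →
    AcceptsWord M (domainOn i) (parallel m ws) ⇔ (∃[ a ] lookup ws i ≡ μ a)
  accepts-domainOn {m = m} i ws b =
    mk⇔ (λ { (a ∷ [] , _ , eq) → a , cong Vec.head eq })
        (λ { (a , eq) → (a ∷ []) , _ , cong (_∷ []) eq })
    ⇔-∘ ⇔-sym (proj₂ domain _)
    ⇔-∘ accepts-saturate-parallel M (proj₁ domain) _ (Bounded-rename (i ∷ []) ws b)
    ⇔-∘ ≡⇒⇔ (cong (AcceptsWord M (saturate (proj₁ domain))) (parallel-rename (i ∷ []) ws m))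
    ⇔-∘ accepts-rename M (i ∷ []) (saturate (proj₁ domain)) (parallel m ws)

  encode : Vec (Carrier N) n → Vec (List (Carrier M)) n
  encode = map μ

  encode-injective : (v v′ : Vec (Carrier N) n) → encode v ≡ encode v′ → v ≡ v′
  encode-injective []      []        _  = refl
  encode-injective (a ∷ v) (a′ ∷ v′) eq =
    cong₂ _∷_ (injective (cong Vec.head eq)) (encode-injective v v′ (cong Vec.tail eq))

  module _ (em : ExcludedMiddle 0ℓ) where

    -- The hypothesis on `B` concerns all lengths `l`, because the code of a witness may exceed the
    -- bound `m` for the given tapes.
    ∃-project : (B : SymbolicAutomaton L (suc n)) (P : Carrier N → Set)
      (ws : Vec (List (Carrier M)) n) → Bounded m ws →
      (∀ a {l} → Bounded l (μ a ∷ ws) → AcceptsWord M B (parallel l (μ a ∷ ws)) ⇔ P a) →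
      AcceptsWord M (project (domainOn zero ⊗ B)) (parallel m ws) ⇔ (∃[ a ] P a)
    ∃-project {n = n} {m = m} B P ws b B⇔P = mk⇔ decode lift
      ⇔-∘ accepts-project M em (domainOn zero ⊗ B) (parallel m ws)
      where
      D = proj₁ domain

      bound : ∀ {w k} → length w ≤ m + k → Bounded (m + k) (w ∷ ws)
      bound l zero    = l
      bound l (suc i) = ℕ.≤-trans (b i) (ℕ.m≤m+n m _)

      decode : (∃[ us ] (∃[ k ] List.map Vec.tail us ≡ parallel m ws ++ blanks k)
                  × AcceptsWord M (domainOn zero ⊗ B) us) → ∃[ a ] P a
      decode (us , (k , tails) , acc) =
        a , to (B⇔P a (subst (λ w → Bounded _ (w ∷ ws)) w≡μa (bound w-short)))
               (subst (AcceptsWord M B)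
                 (trans us≡ (cong (λ w → parallel (m + k) (w ∷ ws)) w≡μa)) (proj₂ parts))
        where
        -- The `k` extra blanks are exactly the padding of `ws` from length `m` to `m + k`.
        tails′ : List.map Vec.tail us ≡ parallel (m + k) ws
        tails′ = trans tails (sym (parallel-blanks ws b k))

        heads : List (Letter M 1)
        heads = List.map (λ u → map (lookup u) (zero ∷ [])) us

        length-heads : length heads ≡ m + k
        length-heads = trans (length-map _ us) (trans (sym (length-map Vec.tail us))
          (trans (cong length tails′) (length-applyUpTo _ (m + k))))

        parts : AcceptsWord M (domainOn zero) us × AcceptsWord M B us
        parts = to (accepts-⊗ M (domainOn zero) B us) acc

        single : ∃[ w ] length w ≤ length heads
                      × heads ≡ parallel (length heads) (w ∷ [])
                      × (w ∷ []) ∈ Accepts M D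
        -- The domain automaton forces the guessed first tape to be a padded word `w` which is a
        -- code.
        single = accepts-saturate-single M D heads
          (to (accepts-rename M (zero ∷ []) (saturate D) us) (proj₁ parts))

        w = proj₁ single

        w-short : length w ≤ m + k
        w-short = subst (length w ≤_) length-heads (proj₁ (proj₂ single))

        us≡ : us ≡ parallel (m + k) (w ∷ ws)
        us≡ = applyUpTo-∷ (λ i → letter i w) (λ i → map (letter i) ws) (m + k) us
          (subst (λ l → heads ≡ parallel l (w ∷ [])) length-heads
            (proj₁ (proj₂ (proj₂ single)))) tails′

        w∈image : ∃[ a ] w ≡ μ a
        w∈image with from (proj₂ domain (w ∷ [])) (proj₂ (proj₂ (proj₂ single)))
        ... | a ∷ [] , _ , eq = a , cong Vec.head eq

        a = proj₁ w∈image
        w≡μa = proj₂ w∈image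

      lift : (∃[ a ] P a) → ∃[ us ] (∃[ k ] List.map Vec.tail us ≡ parallel m ws ++ blanks k)
                  × AcceptsWord M (domainOn zero ⊗ B) us
      -- Length `m + ℓ` has room for the given tapes and for the code of the witness.
      lift (a , p) = parallel (m + ℓ) (μ a ∷ ws) ,
        (ℓ , trans (map-applyUpTo _ _ (m + ℓ)) (parallel-blanks ws b ℓ)) ,
        from (accepts-⊗ M (domainOn zero) B (parallel (m + ℓ) (μ a ∷ ws)))
          (from (accepts-domainOn zero (μ a ∷ ws) b′) (a , refl) , from (B⇔P a b′) p)
        where
        ℓ = length (μ a)
        b′ = bound (ℕ.m≤n+m ℓ m)

    -- Induction on the formula, for all sufficient lengths at once. Besides its use for `∁` and
    -- `project`, excluded middle removes the double negations left by the classical encodings of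
    -- connectives.
    accepts-compile : (φ : Formula K n) (v : Vec (Carrier N) n) → Bounded m (encode v) →
      AcceptsWord M (compile φ) (parallel m (encode v)) ⇔ N ⊨ φ [ v ]

    rejects-compile : (φ : Formula K n) (v : Vec (Carrier N) n) → Bounded m (encode v) →
      AcceptsWord M (∁ (compile φ)) (parallel m (encode v)) ⇔ (¬ N ⊨ φ [ v ])
    rejects-compile {m = m} φ v b =
      →-cong-⇔ (accepts-compile φ v b) (⇔-id _)
      ⇔-∘ accepts-∁ M em (compile φ) (parallel m (encode v))

    accepts-compile {m = m} (rel R xs) v b =
      -- The image provides some preimage `v′`; injectivity of `μ` identifies it with the tuple
      -- named by `xs`.
      mk⇔ (λ (v′ , r , eq) → subst (Structure.⟦_⟧ N R)
            (encode-injective _ _ (sym (trans (sym encode-xs) eq))) r)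
          (λ r → _ , r , encode-xs)
      ⇔-∘ ⇔-sym (proj₂ (relations R) _)
      ⇔-∘ accepts-saturate-parallel M C _ (Bounded-rename xs (encode v) b)
      ⇔-∘ ≡⇒⇔ (cong (AcceptsWord M (saturate C)) (parallel-rename xs (encode v) m))
      ⇔-∘ accepts-rename M xs (saturate C) (parallel m (encode v))
      where
      C = proj₁ (relations R)
      encode-xs : map (lookup (encode v)) xs ≡ encode (map (lookup v) xs)
      encode-xs = map-lookup-map μ v xs
    accepts-compile (x ≈ y) v b =
      mk⇔ injective (cong μ)
      ⇔-∘ ≡⇒⇔ (cong₂ _≡_ (lookup-map x μ v) (lookup-map y μ v))
      ⇔-∘ accepts-equalTapes-parallel M x y (encode v) b
    accepts-compile false v b = mk⇔ (λ { (() , _) }) (λ ())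
    accepts-compile {m = m} (φ ∧ ψ) v b =
      (accepts-compile φ v b ×-⇔ accepts-compile ψ v b)
      ⇔-∘ accepts-⊗ M (compile φ) (compile ψ) (parallel m (encode v))
    accepts-compile {m = m} (φ ∨ ψ) v b =
      mk⇔ (λ h → decidable-stable em λ ¬∨ → h ((¬∨ ∘ inj₁) , (¬∨ ∘ inj₂)))
          [ (λ p (¬p , _) → ¬p p) , (λ q (_ , ¬q) → ¬q q) ]
      ⇔-∘ →-cong-⇔ ((rejects-compile φ v b ×-⇔ rejects-compile ψ v b)
                      ⇔-∘ accepts-⊗ M (∁ (compile φ)) (∁ (compile ψ)) (parallel m (encode v)))
                   (⇔-id _)
      ⇔-∘ accepts-∁ M em (∁ (compile φ) ⊗ ∁ (compile ψ)) (parallel m (encode v))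
    accepts-compile {m = m} (φ ⇒ ψ) v b =
      mk⇔ (λ h p → decidable-stable em λ ¬q → h (p , ¬q)) (λ f (p , ¬q) → ¬q (f p))
      ⇔-∘ →-cong-⇔ ((accepts-compile φ v b ×-⇔ rejects-compile ψ v b)
                      ⇔-∘ accepts-⊗ M (compile φ) (∁ (compile ψ)) (parallel m (encode v))) (⇔-id _)
      ⇔-∘ accepts-∁ M em (compile φ ⊗ ∁ (compile ψ)) (parallel m (encode v))
    accepts-compile {m = m} (all φ) v b =
      mk⇔ (λ h a → decidable-stable em λ ¬p → h (a , ¬p)) (λ p (a , ¬p) → ¬p (p a))
      ⇔-∘ →-cong-⇔ (∃-project (∁ (compile φ)) (λ a → ¬ N ⊨ φ [ a ∷ v ]) (encode v) b
                      (λ a → rejects-compile φ (a ∷ v))) (⇔-id _)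
      ⇔-∘ accepts-∁ M em (project (domainOn zero ⊗ ∁ (compile φ))) (parallel m (encode v))
    accepts-compile (ex φ) v b =
      ∃-project (compile φ) (λ a → N ⊨ φ [ a ∷ v ]) (encode v) b (λ a → accepts-compile φ (a ∷ v))

    -- `compile φ` is correct on codes only, so it is intersected with the domain automaton on every
    -- tape. The preimage tuple is then found tape by tape.
    definable-recognizable : (R : Pred (Vec (Carrier N) n) 0ℓ) →
                             FirstOrderDefinable N R → Recognizable M (image μ R)
    definable-recognizable {n = n} R (φ , R⇔φ) = realize M em C , λ ws →
      ⇔-sym (accepts-C ws ⇔-∘ accepts-realize M em C ws)
      where
      Domains = ⨂ {m = n} domainOn
      Φ = compile φ
      C = Domains ⊗ Φ

      accepts-C : ∀ ws → AcceptsWord M C ⟨ ws ⟩ ⇔ ws ∈ image μ R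
      accepts-C ws = mk⇔ fwd bwd
        where
        fwd : AcceptsWord M C ⟨ ws ⟩ → ws ∈ image μ R
        fwd acc = v , from (R⇔φ v) (to (accepts-compile φ v (maxLength-bounds (encode v)))
                        (subst (λ ws → AcceptsWord M Φ ⟨ ws ⟩) ws≡ (proj₂ parts))) , ws≡
          where
          parts = to (accepts-⊗ M Domains Φ ⟨ ws ⟩) acc

          preimage : ∀ i → ∃[ a ] lookup ws i ≡ μ a
          preimage i = to (accepts-domainOn i ws (maxLength-bounds ws))
            (to (accepts-⨂ M domainOn ⟨ ws ⟩) (proj₁ parts) i)

          v = tabulate (proj₁ ∘ preimage)

          ws≡ : ws ≡ encode v
          ws≡ = trans (sym (tabulate∘lookup ws))
            (trans (tabulate-cong (proj₂ ∘ preimage)) (tabulate-∘ μ (proj₁ ∘ preimage)))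

        bwd : ws ∈ image μ R → AcceptsWord M C ⟨ ws ⟩
        bwd (v , r , refl) = from (accepts-⊗ M Domains Φ ⟨ encode v ⟩)
          ( from (accepts-⨂ M domainOn ⟨ encode v ⟩) (λ i →
              from (accepts-domainOn i (encode v) (maxLength-bounds (encode v)))
              (lookup v i , lookup-map i μ v))
          , from (accepts-compile φ v (maxLength-bounds (encode v))) (to (R⇔φ v) r))

  -- Reducing the theory of `N` to that of `M`

  acceptance : SymbolicAutomaton L 0 → Sentence L
  acceptance A = unpad [] (⋁ λ q → initial A q ∧ final A q)

  ⊨acceptance : (A : SymbolicAutomaton L 0) → M ⊨ acceptance A [ [] ] ⇔ AcceptsWord M A []
  ⊨acceptance A = ⊨⋁ (pad M) _ ⇔-∘ ⊨unpad M [] (⋁ λ q → initial A q ∧ final A q) []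

  theory-reducible : EffectivelyReducible (Theory N) (Theory M)
  -- Neither function takes excluded middle, which only the correctness proof receives. Without
  -- tapes, length 0 is sufficient and `parallel 0 []` is the empty word.
  theory-reducible = acceptance ∘ compile , λ em φ →
    ⇔-sym (accepts-compile em {m = 0} φ [] (λ ()) ⇔-∘ ⊨acceptance (compile φ))

theorem3p9 :
  ∀ {L : Language} (M : Structure L) {k : ℕ} (arities : Vec ℕ k)
    (N : Structure (finiteLanguage arities)) (μ : Carrier N → List (Carrier M)) →
  AutomaticVia M N μ →
  Classically (∀ (n : ℕ) (R : Pred (Vec (Carrier N) n) 0ℓ) →
               FirstOrderDefinable N R → Recognizable M (image μ R))
  × EffectivelyReducible (Theory N) (Theory M)
  × (EffectivelyDecidable (Theory M) → EffectivelyDecidable (Theory N))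
theorem3p9 M arities N μ N-automatic =
    (λ em n → definable-recognizable M N μ N-automatic em)
  , theory-reducible M N μ N-automatic
  , λ (d , d-correct) → let f , f-correct = theory-reducible M N μ N-automatic in
      d ∘ f , λ em φ → d-correct em (f φ) ⇔-∘ f-correct em φ
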